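{- Every quasi-line graph $G$ satisfies $\chi_{\mathrm{pcf}}(G)\le \Delta(G)+4$.
   Context: Graphs are finite and simple. A graph $G$ is quasi-line if for every $v\in V(G)$ the neighborhood $N(v)$ is the union of two cliques. $\Delta(G)$ is the maximum degree. A proper conflict-free coloring of $G$ is a proper vertex coloring in which, for every non-isolated vertex $v$, some color appears exactly once in the open neighborhood $N(v)$. $\chi_{\mathrm{pcf}}(G)$ is the least $k$ such that $G$ has a proper conflict-free coloring with $k$ colors. -}

module Defs where

open import Data.Fin.Base using (Fin; finToFun; funToFin)
open import Data.Fin.Properties as Fin using (all?; any?; finToFun-funToFin)
open import Data.Fin.Subset using (Subset; _∈_; _∪_; ∣_∣; Nonempty)
open import Data.Fin.Subset.Properties using (_∈?_; nonempty?)
open import Data.List.Base using (map; allFin)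
open import Data.List.Extrema.Nat using (max)
open import Data.Nat.Base using (ℕ; zero; suc; _≤_; z≤n; s≤s; _^_)
open import Data.Product using (∃; ∃!; ∃₂; _×_; _,_; proj₁; proj₂)
open import Data.Vec.Base using (tabulate)
open import Function.Base using (id; _∘_)
open import Relation.Binary.Core using (Rel)
open import Relation.Binary.Definitions using (Irreflexive; Symmetric; Decidable)
open import Relation.Binary.PropositionalEquality using (_≡_; _≢_; _≗_; refl; sym; trans)
open import Relation.Nullary.Decidable using (Dec; yes; no; does; map′; _×-dec_; _→-dec_; ¬?)
open import Relation.Nullary.Negation using (contradiction)
import Relation.Unary as U
open import Level using (0ℓ)

-- Finite simple graphs with vertex set Fin n.
record Graph (n : ℕ) : Set₁ where
  field
    Adj        : Rel (Fin n) 0ℓ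
    Adj?       : Decidable Adj
    Adj-sym    : Symmetric Adj
    Adj-irrefl : Irreflexive _≡_ Adj

module _ {n : ℕ} (G : Graph n) where
  open Graph G

  -- Open neighborhood.
  N : Fin n → Subset n
  N v = tabulate (λ u → does (Adj? v u))

  degree : Fin n → ℕ
  degree v = ∣ N v ∣

  -- The graph with no vertices gets Δ = 0.
  Δ : ℕ
  Δ = max 0 (map degree (allFin n))

  IsClique : Subset n → Set
  IsClique K = ∀ {x y} → x ∈ K → y ∈ K → x ≢ y → Adj x y

  -- The two cliques may overlap, and either may be empty.
  QuasiLine : Set
  QuasiLine = ∀ v → ∃₂ λ A B → IsClique A × IsClique B × N v ≡ A ∪ B

  Proper : ∀ {k} → (Fin n → Fin k) → Set
  Proper c = ∀ u v → Adj u v → c u ≢ c v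

  AppearsOnce : ∀ {k} → (Fin n → Fin k) → Fin n → Fin k → Set
  AppearsOnce c v a = ∃! _≡_ λ u → u ∈ N v × c u ≡ a

  ConflictFree : ∀ {k} → (Fin n → Fin k) → Set
  ConflictFree c = ∀ v → Nonempty (N v) → ∃ λ a → AppearsOnce c v a

  IsPCF : ∀ {k} → (Fin n → Fin k) → Set
  IsPCF c = Proper c × ConflictFree c

  PCFColorable : ℕ → Set
  PCFColorable k = ∃ λ (c : Fin n → Fin k) → IsPCF c

  proper? : ∀ {k} (c : Fin n → Fin k) → Dec (Proper c)
  proper? c = all? λ u → all? λ v → Adj? u v →-dec ¬? (c u Fin.≟ c v)

  appearsOnce? : ∀ {k} (c : Fin n → Fin k) v a → Dec (AppearsOnce c v a)
  appearsOnce? c v a = any? λ u → P? u ×-dec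
    map′ (λ f {y} → f y) (λ f y → f {y}) (all? λ y → P? y →-dec (u Fin.≟ y))
    where
    P? : ∀ u → Dec (u ∈ N v × c u ≡ a)
    P? u = (u ∈? N v) ×-dec (c u Fin.≟ a)

  conflictFree? : ∀ {k} (c : Fin n → Fin k) → Dec (ConflictFree c)
  conflictFree? c = all? λ v → nonempty? (N v) →-dec any? (appearsOnce? c v)

  IsPCF-resp-≗ : ∀ {k} {c d : Fin n → Fin k} → c ≗ d → IsPCF c → IsPCF d
  IsPCF-resp-≗ c≗d (p , q) =
    (λ u v uv du≡dv → p u v uv (trans (c≗d u) (trans du≡dv (sym (c≗d v))))) ,
    (λ v ne → let (a , u , (u∈N , cu≡a) , unique) = q v ne in
      a , u , (u∈N , trans (sym (c≗d u)) cu≡a) ,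
      λ { (y∈N , dy≡a) → unique (y∈N , trans (c≗d _) dy≡a) })

  -- Colorings Fin n → Fin k are enumerated by Fin (k ^ n).
  pcfColorable? : U.Decidable PCFColorable
  pcfColorable? k = map′
    (λ (i , h) → finToFun i , h)
    (λ (c , h) → funToFin c , IsPCF-resp-≗ (λ i → sym (finToFun-funToFin c i)) h)
    (any? {n = k ^ n} λ i → proper? (finToFun i) ×-dec conflictFree? (finToFun i))

  -- Giving all vertices distinct colors is a proper conflict-free coloring.
  pcfColorable-order : PCFColorable n
  pcfColorable-order = id , (λ _ _ uv u≡v → Adj-irrefl u≡v uv) ,
    λ { v (u , u∈N) → u , u , (u∈N , refl) , λ (_ , y≡u) → sym y≡u }

IsLeast : (ℕ → Set) → ℕ → Set
IsLeast P k = P k × (∀ j → P j → k ≤ j)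

least : ∀ {P : ℕ → Set} → U.Decidable P → ∀ m → P m → ∃ (IsLeast P)
least P? zero    p = zero , p , λ _ _ → z≤n
least P? (suc m) p with P? zero
... | yes p₀ = zero , p₀ , λ _ _ → z≤n
... | no ¬p₀ with least (P? ∘ suc) m p
...   | k , q , k≤ = suc k , q , λ
        { zero    p₀ → contradiction p₀ ¬p₀
        ; (suc j) pⱼ → s≤s (k≤ j pⱼ) }

module _ {n : ℕ} (G : Graph n) where

  leastPCFColorable : ∃ (IsLeast (PCFColorable G))
  leastPCFColorable = least (pcfColorable? G) n (pcfColorable-order G)

  χpcf : ℕ
  χpcf = proj₁ leastPCFColorable

  χpcf-isLeast : IsLeast (PCFColorable G) χpcf
  χpcf-isLeast = proj₂ leastPCFColorable

{-# OPTIONS --safe #-}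
-- Only claw-freeness of G is used. Let R be a maximal set of vertices at pairwise distance at
-- least 3 and reserve one color, star, for R. A neighbor of R sees star exactly once, so only
-- R and the vertices at distance 2 from R can be bad, that is, see each of their colors at
-- least twice. Starting from any proper coloring, bad vertices are repaired one at a time.
--
-- A bad vertex v has a neighbor u adjacent to some r ∈ R; the neighbors of u that may turn bad
-- when u is recolored are r and the clique K of neighbors of u at distance 2 from R. By
-- claw-freeness each vertex x has at most one color that, given to a fixed neighbor of x and
-- proper there, makes x bad (the spoiler). If u has no suitable color, then some w ∈ K is bad
-- for some color of u, hence sees few colors, and w can be recolored together with u. This
-- fails only if it makes another y ∈ K bad, which then also sees few colors and can take the
-- role of w. In that case w is the only vertex of K whose color occurs once in N(y) ∖ u, so y
-- determines w; hence the search never revisits a vertex and terminates.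
module Submission where

open import Defs
open import Data.Bool.Base using (true; false)
open import Data.Empty using (⊥; ⊥-elim)
open import Data.Fin.Base using (Fin; zero; suc)
open import Data.Fin.Properties using (_≟_; any?; all?; injective⇒≤; ¬∀⟶∃¬)
open import Data.Fin.Subset using (Subset; ⊤; _⊂_; _-_; ∣_∣; ⁅_⁆) renaming (_∈_ to _∈ₛ_)
open import Data.Fin.Subset.Induction using (⊂-wellFounded; Acc; acc)
open import Data.Fin.Subset.Properties
  using (∈⊤; x∈p⇒p-x⊂p; x∈p∧x≢y⇒x∈p-y; p─q⊆p; p─q─q≡p─q; ⊂-irref; x∈p∪q⁻)
open import Data.List.Base using (List; []; _∷_; map; filter; length; tabulate; allFin)
open import Data.List.Extrema.Nat using (xs≤max)
open import Data.List.Membership.Propositional using (_∈_; _∉_; find; lose)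
open import Data.List.Membership.Propositional.Properties
  using (∈-allFin; ∈-map⁺; ∈-filter⁺)
import Data.List.Membership.DecPropositional as DecMembership
import Data.List.Membership.Setoid.Properties as Setoidₚ
open import Data.List.Properties using (length-map)
open import Data.List.Relation.Unary.All using (lookup)
open import Data.List.Relation.Unary.Any using (here; there)
import Data.List.Relation.Unary.Any as Any
open import Data.Nat.Base using (ℕ; zero; suc; _+_; _≤_; _<_)
open import Data.Nat.Properties using (≤-trans; ≤-reflexive; ≤⇒≯; +-monoʳ-≤; +-comm)
open import Data.Product using (∃; _×_; _,_; proj₁; proj₂)
open import Data.Sum.Base using (_⊎_; inj₁; inj₂)
import Data.Vec.Base as Vec
open import Data.Vec.Functional using (updateAt)
open import Data.Vec.Functional.Properties using (updateAt-updates; updateAt-minimal)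
open import Data.Vec.Properties using (lookup∘tabulate; lookup⇒[]=; []=⇒lookup)
open import Function.Base using (const; _∘_; case_of_)
open import Relation.Binary.Core using (Rel)
open import Relation.Binary.Definitions using (Reflexive; Symmetric; Decidable)
open import Relation.Binary.PropositionalEquality
open import Relation.Nullary.Decidable
  using (Dec; yes; no; does; dec-true; decidable-stable; _×-dec_; _⊎-dec_; _→-dec_; ¬?)
open import Relation.Nullary.Negation using (¬_; contradiction)
import Relation.Unary as U
open import Level using (0ℓ)

-- Free colors, greedy packings and iteration over finite sets.

fresh : ∀ {k} (xs : List (Fin k)) → length xs < k → ∃ λ q → q ∉ xs
fresh {k} xs len<k = ¬∀⟶∃¬ k (_∈ xs) (_∈? xs) λ all∈ →
  ≤⇒≯ (injective⇒≤ λ {i} {j} → Setoidₚ.index-injective (setoid (Fin k)) (all∈ i) (all∈ j)) len<k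
  where open DecMembership {A = Fin k} _≟_ using (_∈?_)

length-filter-tabulate : ∀ {m} {A : Set} {P : U.Pred A 0ℓ} (P? : U.Decidable P) (g : Fin m → A) →
  length (filter P? (tabulate g)) ≡ ∣ Vec.tabulate (λ i → does (P? (g i))) ∣
length-filter-tabulate {zero}  P? g = refl
length-filter-tabulate {suc m} P? g with does (P? (g zero))
... | true  = cong suc (length-filter-tabulate P? (g ∘ suc))
... | false = length-filter-tabulate P? (g ∘ suc)

maximalIndependent : ∀ {n} {_~_ : Rel (Fin n) 0ℓ} → Decidable _~_ → Reflexive _~_ → Symmetric _~_ →
  ∃ λ R → (∀ {a b} → a ∈ R → b ∈ R → a ≢ b → ¬ a ~ b) × (∀ x → ∃ λ r → r ∈ R × x ~ r)
maximalIndependent {n} {_~_} _~?_ rfl symm =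
  let (R , ind , dom) = go (allFin n) in R , ind , λ x → dom (∈-allFin x)
  where
  go : ∀ xs → ∃ λ R → (∀ {a b} → a ∈ R → b ∈ R → a ≢ b → ¬ a ~ b) ×
                      (∀ {x} → x ∈ xs → ∃ λ r → r ∈ R × x ~ r)
  go [] = [] , (λ ()) , λ ()
  go (x ∷ xs) with go xs
  ... | R , ind , dom with Any.any? (x ~?_) R
  ...   | yes near = R , ind , λ { (here refl) → find near ; (there y∈) → dom y∈ }
  ...   | no ¬near = x ∷ R ,
    (λ { (here refl) (here refl) a≢b _ → a≢b refl
       ; (here refl) (there b∈) _ a~b → ¬near (lose b∈ a~b)
       ; (there a∈) (here refl) _ a~b → ¬near (lose a∈ (symm a~b))
       ; (there a∈) (there b∈) → ind a∈ b∈ }) ,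
    λ { (here refl) → x , here refl , rfl
      ; (there y∈) → let (r , r∈ , y~r) = dom y∈ in r , there r∈ , y~r }

-- A walk along an injective relation that starts at a point without predecessor never repeats,
-- so following it must reach Done.
chase : ∀ {n} {Done : Set} {X : Fin n → Set} {E : Rel (Fin n) 0ℓ} →
  (∀ {a b y} → E a y → E b y → a ≡ b) →
  (∀ z → X z → Done ⊎ ∃ λ y → X y × E z y) →
  ∀ z → X z → (∀ a → ¬ E a z) → Done
chase {n} {Done} {X} {E} inj step z₀ Xz₀ source =
  go ⊤ (⊂-wellFounded ⊤) z₀ Xz₀ ∈⊤ λ {a} Eay _ → ∈⊤ , λ { refl → source a Eay }
  where
  x∉p-x : ∀ (p : Subset n) x → ¬ x ∈ₛ p - x
  x∉p-x p x x∈ = ⊂-irref (p─q─q≡p─q p ⁅ x ⁆) (x∈p⇒p-x⊂p x∈)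

  -- `p` holds the vertices not yet left behind. `inv` survives the removal of `z` because `z` was
  -- the only predecessor of `y`.
  go : ∀ p → Acc _⊂_ p → ∀ z → X z → z ∈ₛ p →
       (∀ {a y} → E a y → a ∈ₛ p → y ∈ₛ p × y ≢ z) → Done
  go p (acc rs) z Xz z∈p inv with step z Xz
  ... | inj₁ done = done
  ... | inj₂ (y , Xy , Ezy) =
    let (y∈p , y≢z) = inv Ezy z∈p in
    go (p - z) (rs (x∈p⇒p-x⊂p z∈p)) y Xy (x∈p∧x≢y⇒x∈p-y y∈p y≢z) λ Eay' a∈ →
      let (y'∈p , y'≢z) = inv Eay' (p─q⊆p p ⁅ z ⁆ a∈) in
      x∈p∧x≢y⇒x∈p-y y'∈p y'≢z ,
      λ { refl → x∉p-x p z (subst (_∈ₛ p - z) (inj Eay' Ezy) a∈) }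

-- One pass over the vertices suffices because a repair never destroys `P` elsewhere.
repairAll : ∀ {n} {C : Set} {V : C → Set} {P : C → Fin n → Set} →
  (∀ φ → V φ → ∀ v → ∃ λ ψ → V ψ × P ψ v × (∀ x → P φ x → P ψ x)) →
  ∀ φ → V φ → ∃ λ ψ → V ψ × ∀ v → P ψ v
repairAll {n} {C} {V} {P} repair φ₀ V₀ =
  let (ψ , Vψ , Pψ) = go (allFin n) in ψ , Vψ , λ v → Pψ (∈-allFin v)
  where
  go : ∀ xs → ∃ λ ψ → V ψ × (∀ {v} → v ∈ xs → P ψ v)
  go [] = φ₀ , V₀ , λ ()
  go (v ∷ xs) with go xs
  ... | φ , Vφ , Pφ with repair φ Vφ v
  ...   | ψ , Vψ , Pψv , keep = ψ , Vψ , λ { (here refl) → Pψv ; (there x∈) → keep _ (Pφ x∈) }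

-- Neighborhoods, distance at most two, and claws.

module _ {n : ℕ} (G : Graph n) where
  open Graph G

  ∈N⇒Adj : ∀ {u v} → u ∈ₛ N G v → Adj v u
  ∈N⇒Adj {u} {v} u∈ with Adj? v u | trans (sym (lookup∘tabulate (does ∘ Adj? v) u)) ([]=⇒lookup u∈)
  ... | yes vu | _ = vu
  ... | no _   | ()

  Adj⇒∈N : ∀ {u v} → Adj v u → u ∈ₛ N G v
  Adj⇒∈N {u} {v} vu = lookup⇒[]= u _ (trans (lookup∘tabulate _ u) (dec-true (Adj? v u) vu))

  neighbors : Fin n → List (Fin n)
  neighbors v = filter (Adj? v) (allFin n)

  length-neighbors≤Δ : ∀ v → length (neighbors v) ≤ Δ G
  length-neighbors≤Δ v = ≤-trans (≤-reflexive (length-filter-tabulate (Adj? v) (λ i → i)))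
    (lookup (xs≤max 0 (map (degree G) (allFin n))) (∈-map⁺ (degree G) (∈-allFin v)))

  Near : Rel (Fin n) 0ℓ
  Near a b = a ≡ b ⊎ Adj a b ⊎ ∃ λ m → Adj a m × Adj m b

  Near? : Decidable Near
  Near? a b = (a ≟ b) ⊎-dec Adj? a b ⊎-dec any? λ m → Adj? a m ×-dec Adj? m b

  Near-sym : Symmetric Near
  Near-sym (inj₁ refl)                = inj₁ refl
  Near-sym (inj₂ (inj₁ ab))           = inj₂ (inj₁ (Adj-sym ab))
  Near-sym (inj₂ (inj₂ (m , am , mb))) = inj₂ (inj₂ (m , Adj-sym mb , Adj-sym am))

  ClawFree : Set
  ClawFree = ∀ {v a b c} → Adj v a → Adj v b → Adj v c → a ≢ b → a ≢ c → b ≢ c →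
             Adj a b ⊎ Adj a c ⊎ Adj b c

  -- Pigeonhole: two of the three neighbors fall into the same clique.
  quasiLine⇒clawFree : QuasiLine G → ClawFree
  quasiLine⇒clawFree ql {v} va vb vc a≢b a≢c b≢c
    with ql v
  ... | A , B , cA , cB , N≡
    with side va | side vb | side vc
    where
    side : ∀ {x} → Adj v x → x ∈ₛ A ⊎ x ∈ₛ B
    side vx = x∈p∪q⁻ A B (subst (_ ∈ₛ_) N≡ (Adj⇒∈N vx))
  ... | inj₁ a | inj₁ b | _      = inj₁ (cA a b a≢b)
  ... | inj₂ a | inj₂ b | _      = inj₁ (cB a b a≢b)
  ... | inj₁ a | inj₂ b | inj₁ c = inj₂ (inj₁ (cA a c a≢c))
  ... | inj₁ a | inj₂ b | inj₂ c = inj₂ (inj₂ (cB b c b≢c))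
  ... | inj₂ a | inj₁ b | inj₁ c = inj₂ (inj₂ (cA b c b≢c))
  ... | inj₂ a | inj₁ b | inj₂ c = inj₂ (inj₁ (cB a c a≢c))

-- Colorings, bad vertices and spoilers.

module _ {n : ℕ} (G : Graph n) where
  open Graph G

  Color : Set
  Color = Fin (4 + Δ G)

  Coloring : Set
  Coloring = Fin n → Color

  star : Color
  star = zero

  infixl 10 _[_≔_]

  opaque
    _[_≔_] : Coloring → Fin n → Color → Coloring
    φ [ u ≔ q ] = updateAt φ u (const q)

    at : ∀ (φ : Coloring) u {q} → (φ [ u ≔ q ]) u ≡ q
    at φ u = updateAt-updates u φ

    off : ∀ (φ : Coloring) {u x} {q} → x ≢ u → (φ [ u ≔ q ]) x ≡ φ x
    off φ {u} {x} x≢u = updateAt-minimal x u φ x≢u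

  adj⇒≢ : ∀ {u v} → Adj u v → u ≢ v
  adj⇒≢ uv u≡v = Adj-irrefl u≡v uv

  Avoids : Coloring → Fin n → Color → Set
  Avoids φ u q = ∀ t → Adj u t → φ t ≢ q

  opaque
    -- The neighbors exclude at most `Δ G` colors, so three further exclusions still leave one of
    -- the `4 + Δ G`.
    chooseColor : ∀ (φ : Coloring) v a b c → ∃ λ q → Avoids φ v q × q ≢ a × q ≢ b × q ≢ c
    chooseColor φ v a b c with fresh (a ∷ b ∷ c ∷ map φ (neighbors G v))
      (+-monoʳ-≤ 4 (≤-trans (≤-reflexive (length-map φ (neighbors G v))) (length-neighbors≤Δ G v)))
    ... | q , q∉ = q ,
      (λ { t vt refl → q∉ (there (there (there (∈-map⁺ φ (∈-filter⁺ (Adj? v) (∈-allFin t) vt))))) }) ,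
      (λ q≡a → q∉ (here q≡a)) , (λ q≡b → q∉ (there (here q≡b))) ,
      λ q≡c → q∉ (there (there (here q≡c)))

  

  -- An isolated vertex is vacuously bad; `Fine` sets it aside.
  Bad : Coloring → Fin n → Set
  Bad φ v = ∀ x → Adj v x → ∃ λ y → Adj v y × y ≢ x × φ y ≡ φ x

  bad? : ∀ φ v → Dec (Bad φ v)
  bad? φ v = all? λ x → Adj? v x →-dec any? λ y → Adj? v y ×-dec ¬? (y ≟ x) ×-dec (φ y ≟ φ x)

  Bad-resp : ∀ {φ ψ : Coloring} {v} → (∀ t → Adj v t → φ t ≡ ψ t) → Bad φ v → Bad ψ v
  Bad-resp φ≡ψ bad x vx =
    let (y , vy , y≢x , eq) = bad x vx in
    y , vy , y≢x , trans (sym (φ≡ψ y vy)) (trans eq (φ≡ψ x vx))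

  update-proper : ∀ {φ u q} → Proper G φ → Avoids φ u q → Proper G (φ [ u ≔ q ])
  update-proper {φ} {u} prop av x y xy eq with x ≟ u | y ≟ u
  ... | yes refl | yes refl = adj⇒≢ xy refl
  ... | yes refl | no y≢u = av y xy (trans (sym (off φ y≢u)) (trans (sym eq) (at φ x)))
  ... | no x≢u | yes refl = av x (Adj-sym xy) (trans (sym (off φ x≢u)) (trans eq (at φ y)))
  ... | no x≢u | no y≢u = prop x y xy (trans (sym (off φ x≢u)) (trans eq (off φ y≢u)))

  ¬Bad⇒AppearsOnce : ∀ (φ : Coloring) v → ¬ Bad φ v → ∃ λ a → AppearsOnce G φ v a
  ¬Bad⇒AppearsOnce φ v ¬bad with any? (λ x → Adj? v x ×-dec
      all? (λ y → Adj? v y →-dec ((φ y ≟ φ x) →-dec (x ≟ y))))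
  ... | yes (x , vx , uniq) = φ x , x , (Adj⇒∈N G vx , refl) ,
    λ { {y} (y∈ , eq) → uniq y (∈N⇒Adj G y∈) eq }
  ... | no none = ⊥-elim (¬bad λ x vx → decidable-stable
    (any? λ y → Adj? v y ×-dec ¬? (y ≟ x) ×-dec (φ y ≟ φ x))
    λ lonely → none (x , vx , λ y vy eq → decidable-stable (x ≟ y)
      λ x≢y → lonely (y , vy , (λ y≡x → x≢y (sym y≡x)) , eq)))

  module _ (claw : ClawFree G) where

    noThreeAlike : ∀ {φ : Coloring} {v a b c} → Proper G φ → Adj v a → Adj v b → Adj v c →
      a ≢ b → a ≢ c → b ≢ c → φ a ≡ φ b → φ a ≡ φ c → ⊥
    noThreeAlike prop va vb vc a≢b a≢c b≢c ab ac with claw va vb vc a≢b a≢c b≢c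
    ... | inj₁ e        = prop _ _ e ab
    ... | inj₂ (inj₁ e) = prop _ _ e ac
    ... | inj₂ (inj₂ e) = prop _ _ e (trans (sym ab) ac)

    nonNeighbors-clique : ∀ {v a b c} → Adj v a → Adj v b → Adj v c → a ≢ b → a ≢ c →
      ¬ Adj a b → ¬ Adj a c → b ≢ c → Adj b c
    nonNeighbors-clique va vb vc a≢b a≢c ¬ab ¬ac b≢c with claw va vb vc a≢b a≢c b≢c
    ... | inj₁ e        = contradiction e ¬ab
    ... | inj₂ (inj₁ e) = contradiction e ¬ac
    ... | inj₂ (inj₂ e) = e

    -- Properness at common neighbors is enough for uniqueness, and it admits a `q` that clashes at
    -- `y` with a vertex about to be recolored itself.
    SpoilsAt : Coloring → Fin n → Fin n → Color → Set
    SpoilsAt φ y x q = (∀ t → Adj y t → Adj x t → φ t ≢ q) × Bad (φ [ y ≔ q ]) x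

    spoilsAt? : ∀ φ y x q → Dec (SpoilsAt φ y x q)
    spoilsAt? φ y x q =
      (all? λ t → Adj? y t →-dec Adj? x t →-dec ¬? (φ t ≟ q)) ×-dec bad? (φ [ y ≔ q ]) x

    -- Suppose distinct colors spoil. Since `α` does, some `t` other than `y` in N(x) has color `α`;
    -- since `β` does, so has a further `s`. Claw-freeness gives an edge among `y`, `t`, `s`, but
    -- all three have color `α` once `y` receives it.
    spoiler-unique : ∀ {φ y x α β} → Proper G φ → Adj x y →
      SpoilsAt φ y x α → SpoilsAt φ y x β → α ≡ β
    spoiler-unique {φ} {y} {x} {α} {β} prop xy (avα , badα) (_ , badβ) =
      decidable-stable (α ≟ β) λ α≢β →
        let (t , xt , t≢y , eq) = badα y xy
            φt≡α = trans (sym (off φ t≢y)) (trans eq (at φ y))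
            (s , xs , s≢t , eq') = badβ t xt
            βs≡α = trans eq' (trans (off φ t≢y) φt≡α)
            s≢y : s ≢ y
            s≢y s≡y = α≢β (trans (sym βs≡α) (trans (cong (φ [ y ≔ β ]) s≡y) (at φ y)))
            φs≡α = trans (sym (off φ s≢y)) βs≡α
        in case claw xy xt xs (t≢y ∘ sym) (s≢y ∘ sym) (s≢t ∘ sym) of λ
          { (inj₁ e)        → avα t e xt φt≡α
          ; (inj₂ (inj₁ e)) → avα s e xs φs≡α
          ; (inj₂ (inj₂ e)) → prop t s e (trans φt≡α (sym φs≡α)) }

    opaque
      spoiler : ∀ {φ} → Proper G φ → ∀ {x y} → Adj x y → ∃ λ f → ∀ q → SpoilsAt φ y x q → q ≡ f
      spoiler {φ} prop {x} {y} xy with any? (spoilsAt? φ y x)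
      ... | yes (f , sf) = f , λ q sq → spoiler-unique prop xy sq sf
      -- No color spoils `x` here, so `star` is an arbitrary value.
      ... | no none      = star , λ q sq → contradiction (q , sq) none

    

    -- Valid colorings: one color reserved for a packing.

    module _ (R : List (Fin n))
             (packed : ∀ {a b} → a ∈ R → b ∈ R → a ≢ b → ¬ Near G a b)
             (dominating : ∀ x → ∃ λ r → r ∈ R × Near G x r) where

      open DecMembership {A = Fin n} _≟_ using (_∈?_)

      Touches : Fin n → Set
      Touches x = ∃ λ r → Adj x r × r ∈ R

      touches? : ∀ x → Dec (Touches x)
      touches? x = any? λ r → Adj? x r ×-dec (r ∈? R)

      touches⇒∉R : ∀ {x} → Touches x → x ∉ R
      touches⇒∉R (r , xr , r∈R) x∈R = packed x∈R r∈R (adj⇒≢ xr) (inj₂ (inj₁ xr))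

      record Valid (φ : Coloring) : Set where
        field
          proper    : Proper G φ
          star-on   : ∀ {x} → x ∈ R → φ x ≡ star
          star-only : ∀ {x} → φ x ≡ star → x ∈ R
      open Valid

      update-valid : ∀ {φ x q} → Valid φ → x ∉ R → q ≢ star → Avoids φ x q → Valid (φ [ x ≔ q ])
      update-valid V x∉R q≢star av .proper = update-proper (V .proper) av
      update-valid {φ} V x∉R q≢star av .star-on y∈R =
        trans (off φ λ { refl → x∉R y∈R }) (V .star-on y∈R)
      update-valid {φ} {x} V x∉R q≢star av .star-only {y} eq with y ≟ x
      ... | yes refl = contradiction (trans (sym (at φ x)) eq) q≢star
      ... | no y≢x   = V .star-only (trans (sym (off φ y≢x)) eq)

      touches⇒¬Bad : ∀ {φ x} → Valid φ → Touches x → ¬ Bad φ x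
      touches⇒¬Bad V (r , xr , r∈R) bad =
        let (y , xy , y≢r , eq) = bad r xr in
        packed (V .star-only (trans eq (V .star-on r∈R))) r∈R y≢r
          (inj₂ (inj₂ (_ , Adj-sym xy , xr)))

      -- Local repair around a neighbor of a packed vertex.

      module _ {φ : Coloring} (V : Valid φ) {u r : Fin n} (ur : Adj u r) (r∈R : r ∈ R) where

        K : Fin n → Set
        K z = Adj u z × z ≢ r × ¬ Touches z

        K? : ∀ z → Dec (K z)
        K? z = Adj? u z ×-dec ¬? (z ≟ r) ×-dec ¬? (touches? z)

        u-touches : Touches u
        u-touches = r , ur , r∈R

        data Kind (x : Fin n) : Set where
          touching : Touches x → Kind x
          root     : x ≡ r → Kind x
          inK      : K x → Kind x

        kind : ∀ {x} → Adj u x → Kind x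
        kind {x} ux with touches? x | x ≟ r
        ... | yes t | _        = touching t
        ... | no _  | yes x≡r  = root x≡r
        ... | no ¬t | no x≢r   = inK (ux , x≢r , ¬t)

        K-∉R : ∀ {z} → K z → z ∉ R
        K-∉R (uz , z≢r , _) z∈R = packed z∈R r∈R z≢r (inj₂ (inj₂ (u , Adj-sym uz , ur)))

        K-¬Adj-r : ∀ {z} → K z → ¬ Adj r z
        K-¬Adj-r (_ , _ , ¬t) rz = ¬t (r , Adj-sym rz , r∈R)

        -- Both vertices miss `r` inside N(u), so claw-freeness joins them.
        K-clique : ∀ {y z} → K y → K z → y ≢ z → Adj y z
        K-clique Ky@(uy , y≢r , _) Kz@(uz , z≢r , _) =
          nonNeighbors-clique ur uy uz (y≢r ∘ sym) (z≢r ∘ sym) (K-¬Adj-r Ky) (K-¬Adj-r Kz)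

        avoids⇒≢star : ∀ {q} → Avoids φ u q → q ≢ star
        avoids⇒≢star av q≡star = av r ur (trans (V .star-on r∈R) (sym q≡star))

        Repaired : Set
        Repaired = ∃ λ ψ → Valid ψ × (∀ x → Adj u x → ¬ Bad ψ x) × (∀ x → Bad ψ x → Bad φ x)

        -- A clash with `u` is allowed since `u` is recolored along with `x`. Vertices outside N[u]
        -- do not see that second change; the neighbors of `u` are examined in `step`.
        Recolorable : Fin n → Set
        Recolorable x = ∃ λ p → p ≢ star × p ≢ φ x × (∀ t → Adj x t → t ≢ u → φ t ≢ p) ×
                        (∀ y → Adj x y → ¬ Adj u y → y ≢ u → ¬ Bad (φ [ x ≔ p ]) y)

        -- A vertex x that is bad in ψ sees few colors: every color on N(x) occurs outside the
        -- clique N(x) ∖ N[u]. So each neighbor of x excludes only one color for x, its spoiler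
        -- if it lies in that clique and its own color in ψ otherwise.
        bad⇒recolorable : ∀ {ψ w x} → Proper G ψ → (∀ t → t ≢ u → t ≢ w → ψ t ≡ φ t) →
          K x → Bad ψ x → Recolorable x
        bad⇒recolorable {ψ} {w} {x} propψ ψ≡φ (ux , _) bad =
          -- `excluded` is passed as if it were a coloring: one forbidden color per neighbor. `φ w`
          -- is added because `ψ` may differ from `φ` at `w`.
          let (p , av , p≢star , p≢φx , p≢φw) = chooseColor excluded x star (φ x) (φ w)
          in p , p≢star , p≢φx , free av p≢φw , unspoilt av p≢φw
          where
          Far : Fin n → Set
          Far y = Adj x y × ¬ Adj u y × y ≢ u

          far? : ∀ y → Dec (Far y)
          far? y = Adj? x y ×-dec ¬? (Adj? u y) ×-dec ¬? (y ≟ u)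

          excluded : Coloring
          excluded y with far? y
          ... | yes (xy , _) = proj₁ (spoiler (V .proper) (Adj-sym xy))
          ... | no _         = ψ y

          excluded-far : ∀ {y q} → Far y → SpoilsAt φ x y q → q ≡ excluded y
          excluded-far {y} fy s with far? y
          ... | yes (xy , _) = proj₂ (spoiler (V .proper) (Adj-sym xy)) _ s
          ... | no ¬fy       = contradiction fy ¬fy

          excluded-near : ∀ {y} → ¬ Far y → excluded y ≡ ψ y
          excluded-near {y} ¬fy with far? y
          ... | yes fy = contradiction fy ¬fy
          ... | no _   = refl

          -- Two far vertices `s` and `t` are adjacent, or they would form a claw at `x` with `u`;
          -- so they cannot share a color.
          near-copy : ∀ t → Adj x t → ∃ λ s → Adj x s × ¬ Far s × ψ s ≡ ψ t
          near-copy t xt with far? t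
          ... | no ¬ft = t , xt , ¬ft , refl
          ... | yes (_ , ¬ut , t≢u) =
            let (s , xs , s≢t , eq) = bad t xt in
            s , xs ,
            (λ { (_ , ¬us , s≢u) → propψ s t
                 (nonNeighbors-clique (Adj-sym ux) xs xt (s≢u ∘ sym) (t≢u ∘ sym) ¬us ¬ut s≢t) eq }) ,
            eq

          free : ∀ {p} → Avoids excluded x p → p ≢ φ w → ∀ t → Adj x t → t ≢ u → φ t ≢ p
          free av p≢φw t xt t≢u φt≡p with t ≟ w
          ... | yes refl = p≢φw (sym φt≡p)
          ... | no t≢w   =
            let (s , xs , ¬fs , eq) = near-copy t xt in
            av s xs (trans (excluded-near ¬fs) (trans eq (trans (ψ≡φ t t≢u t≢w) φt≡p)))

          unspoilt : ∀ {p} → Avoids excluded x p → p ≢ φ w →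
                     ∀ y → Adj x y → ¬ Adj u y → y ≢ u → ¬ Bad (φ [ x ≔ p ]) y
          unspoilt av p≢φw y xy ¬uy y≢u bad' = av y xy (sym (excluded-far (xy , ¬uy , y≢u)
            ((λ t xt yt → free av p≢φw t xt λ { refl → ¬uy (Adj-sym yt) }) , bad')))

        Lonely : Fin n → Fin n → Set
        Lonely y x = ∀ t → Adj y t → t ≢ x → t ≢ u → φ t ≢ φ x

        -- The edges of the search are phrased in `φ` alone: each attempt restarts from `φ`, so the
        -- colors tried leave no trace. The last clause makes `y` determine `w`.
        _▷_ : Rel (Fin n) 0ℓ
        w ▷ y = K w × w ≢ y × Lonely y w × (∀ x → K x → x ≢ y → x ≢ w → ¬ Lonely y x)

        ▷-injective : ∀ {a b y} → a ▷ y → b ▷ y → a ≡ b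
        ▷-injective {a} {b} (Ka , a≢y , lonely , _) (_ , _ , _ , others) =
          decidable-stable (a ≟ b) λ a≢b → others a Ka a≢y a≢b lonely

        bad⇒¬Lonely : ∀ {ψ y x} → Bad ψ y → K x → Adj y x → ψ x ≡ φ x →
          (∀ t → Adj y t → ψ t ≡ φ x → t ≢ x → t ≢ u × φ t ≡ φ x) → ¬ Lonely y x
        bad⇒¬Lonely bad Kx yx ψx≡φx same lonely =
          let (t , yt , t≢x , eq) = bad _ yx
              (t≢u , φt≡φx) = same t yt (trans eq ψx≡φx) t≢x
          in lonely t yt t≢x t≢u φt≡φx

        -- Recoloring `u` and a vertex of the clique together.

        module _ {w : Fin n} (Kw : K w) {p : Color} (p≢star : p ≢ star) (p≢φw : p ≢ φ w)
                 (p-free : ∀ t → Adj w t → t ≢ u → φ t ≢ p)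
                 {q : Color} (q-free : Avoids φ u q) (q≢p : q ≢ p) where

          φ₂ : Coloring
          φ₂ = φ [ u ≔ q ] [ w ≔ p ]

          w≢u : w ≢ u
          w≢u = adj⇒≢ (proj₁ Kw) ∘ sym

          φ₂-off : ∀ t → t ≢ u → t ≢ w → φ₂ t ≡ φ t
          φ₂-off t t≢u t≢w = trans (off _ t≢w) (off φ t≢u)

          φ₂-u : φ₂ u ≡ q
          φ₂-u = trans (off _ (w≢u ∘ sym)) (at φ u)

          φ₂-w : φ₂ w ≡ p
          φ₂-w = at _ w

          φ₂-valid : Valid φ₂
          φ₂-valid = update-valid
            (update-valid V (touches⇒∉R u-touches) (avoids⇒≢star q-free) q-free)
            (K-∉R Kw) p≢star avoids
            where
            avoids : Avoids (φ [ u ≔ q ]) w p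
            avoids t wt eq with t ≟ u
            ... | yes refl = q≢p (trans (sym (at φ u)) eq)
            ... | no t≢u   = p-free t wt t≢u (trans (sym (off φ t≢u)) eq)

          φ₂-reflects : ∀ {t x} → K x → p ≢ φ x → φ₂ t ≡ φ x → t ≢ u × t ≢ w × φ t ≡ φ x
          φ₂-reflects {t} {x} (ux , _) p≢φx eq = t≢u , t≢w , trans (sym (φ₂-off t t≢u t≢w)) eq
            where
            t≢u : t ≢ u
            t≢u refl = q-free x ux (trans (sym eq) φ₂-u)
            t≢w : t ≢ w
            t≢w refl = p≢φx (trans (sym φ₂-w) eq)

          -- If the old color of `w` recurred at some `t` in N(y) other than `u`, badness would give
          -- a further `s`, and `w`, `t`, `s` would be alike in `φ`. Every other `x` in `K` keeps
          -- its color, and its repeat is neither `u` nor `w`.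
          φ₂-bad⇒▷ : ∀ {y} → K y → w ≢ y → Bad φ₂ y → w ▷ y
          φ₂-bad⇒▷ {y} Ky w≢y bad = Kw , w≢y , lonely , others
            where
            yw : Adj y w
            yw = K-clique Ky Kw (w≢y ∘ sym)

            lonely : Lonely y w
            lonely t yt t≢w t≢u φt≡φw =
              let (s , ys , s≢t , eq) = bad t yt
                  (s≢u , s≢w , φs≡φw) = φ₂-reflects Kw p≢φw
                    (trans eq (trans (φ₂-off t t≢u t≢w) φt≡φw))
              in noThreeAlike (V .proper) yw yt ys (t≢w ∘ sym) (s≢w ∘ sym) (s≢t ∘ sym)
                   (sym φt≡φw) (sym φs≡φw)

            others : ∀ x → K x → x ≢ y → x ≢ w → ¬ Lonely y x
            others x Kx x≢y x≢w = bad⇒¬Lonely bad Kx (K-clique Ky Kx (x≢y ∘ sym))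
              (φ₂-off x x≢u x≢w)
              λ t yt eq t≢x → let (t≢u , _ , eq') = φ₂-reflects Kx p≢φx eq in t≢u , eq'
              where
              x≢u : x ≢ u
              x≢u = adj⇒≢ (proj₁ Kx) ∘ sym
              p≢φx : p ≢ φ x
              p≢φx p≡φx = p-free x (K-clique Kw Kx (x≢w ∘ sym)) x≢u (sym p≡φx)

        step : ∀ w → K w × Recolorable w → Repaired ⊎ ∃ λ y → (K y × Recolorable y) × w ▷ y
        step w (Kw , p , p≢star , p≢φw , p-free , p-unspoilt)
          with spoiler (V .proper) (Adj-sym ur) | spoiler (V .proper) (Adj-sym (proj₁ Kw))
        -- The three extra exclusions are `p`, because `u` and `w` are adjacent, and the spoilers of
        -- `r` and `w`. Neither `r` nor `w` is adjacent to `w`, so only the new color of `u` can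
        -- make them bad.
        ... | fr , spoils-r | fw , spoils-w with chooseColor φ u p fr fw
        ...   | q , q-free , q≢p , q≢fr , q≢fw
          with any? (λ y → K? y ×-dec ¬? (w ≟ y) ×-dec bad? (φ₂ Kw p≢star p≢φw p-free q-free q≢p) y)
        ...   | yes (y , Ky , w≢y , bad) = inj₂ (y ,
                (Ky , bad⇒recolorable
                   (φ₂-valid Kw p≢star p≢φw p-free q-free q≢p .proper)
                   (φ₂-off Kw p≢star p≢φw p-free q-free q≢p) Ky bad) ,
                φ₂-bad⇒▷ Kw p≢star p≢φw p-free q-free q≢p Ky w≢y bad)
        ...   | no none = inj₁ (ψ , Vψ , good , reflects)
          where
          ψ : Coloring
          ψ = φ₂ Kw p≢star p≢φw p-free q-free q≢p

          Vψ : Valid ψ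
          Vψ = φ₂-valid Kw p≢star p≢φw p-free q-free q≢p

          unmoved : ∀ {x} → ¬ Adj x w → Bad ψ x → Bad (φ [ u ≔ q ]) x
          unmoved ¬xw = Bad-resp λ t xt → off (φ [ u ≔ q ]) λ { refl → ¬xw xt }

          good : ∀ x → Adj u x → ¬ Bad ψ x
          good x ux bad with kind ux
          ... | touching t = touches⇒¬Bad Vψ t bad
          ... | root refl  = q≢fr (spoils-r q ((λ t ut _ → q-free t ut) ,
                               unmoved (K-¬Adj-r Kw) bad))
          ... | inK Kx with w ≟ x
          ...   | yes refl = q≢fw (spoils-w q ((λ t ut _ → q-free t ut) ,
                               unmoved (Adj-irrefl refl) bad))
          ...   | no w≢x   = none (x , Kx , w≢x , bad)

          reflects : ∀ x → Bad ψ x → Bad φ x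
          reflects x bad with Adj? u x | Adj? w x | x ≟ u
          ... | yes ux | _      | _        = contradiction bad (good x ux)
          ... | no _   | _      | yes refl = contradiction bad (touches⇒¬Bad Vψ u-touches)
          ... | no ¬ux | no ¬wx | no _     = Bad-resp
            (λ t xt → off φ λ { refl → ¬ux (Adj-sym xt) })
            (unmoved (¬wx ∘ Adj-sym) bad)
          -- `x` sees the change at `w` but not the one at `u`.
          ... | no ¬ux | yes wx | no x≢u   = contradiction (Bad-resp same bad) (p-unspoilt x wx ¬ux x≢u)
            where
            same : ∀ t → Adj x t → ψ t ≡ (φ [ w ≔ p ]) t
            same t xt with t ≟ w
            ... | yes refl = trans (at _ t) (sym (at φ t))
            ... | no t≢w   = trans (off _ t≢w) (trans (off φ λ { refl → ¬ux (Adj-sym xt) })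
                               (sym (off φ t≢w)))

        -- Recoloring `u` alone, and starting the search.

        module _ {q : Color} (q-free : Avoids φ u q) (r-good : ¬ Bad (φ [ u ≔ q ]) r) where

          private
            φ₁ : Coloring
            φ₁ = φ [ u ≔ q ]

          φ₁-reflects : ∀ {t x} → K x → φ₁ t ≡ φ x → t ≢ u × φ t ≡ φ x
          φ₁-reflects {t} {x} (ux , _) eq = t≢u , trans (sym (off φ t≢u)) eq
            where
            t≢u : t ≢ u
            t≢u refl = q-free x ux (trans (sym eq) (at φ t))

          -- This leaves the first vertex `z` of the search without a predecessor, which would have
          -- to be lonely for `z`.
          φ₁-bad⇒¬Lonely : ∀ {z x} → K z → Bad φ₁ z → K x → x ≢ z → ¬ Lonely z x
          φ₁-bad⇒¬Lonely Kz bad Kx x≢z = bad⇒¬Lonely bad Kx (K-clique Kz Kx (x≢z ∘ sym))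
            (off φ (adj⇒≢ (proj₁ Kx) ∘ sym)) λ _ _ eq _ → φ₁-reflects Kx eq

          repairedBy : Repaired
          repairedBy = case any? (λ y → K? y ×-dec bad? φ₁ y) of λ
            { (yes (z , Kz , bad)) → chase ▷-injective step z
                (Kz , bad⇒recolorable (update-proper (V .proper) q-free)
                        -- Only `u` has moved, so it also fills the place of the second exceptional
                        -- vertex.
                        (λ t t≢u (_ : t ≢ u) → off φ t≢u) Kz bad)
                (λ { x (Kx , x≢z , lonely , _) → φ₁-bad⇒¬Lonely Kz bad Kx x≢z lonely })
            ; (no none) → φ₁ , φ₁-valid , good none , reflects none }
            where
            φ₁-valid : Valid φ₁
            φ₁-valid = update-valid V (touches⇒∉R u-touches) (avoids⇒≢star q-free) q-free

            good : ¬ (∃ λ y → K y × Bad φ₁ y) → ∀ x → Adj u x → ¬ Bad φ₁ x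
            good none x ux bad with kind ux
            ... | touching t = touches⇒¬Bad φ₁-valid t bad
            ... | root refl  = r-good bad
            ... | inK Kx     = none (x , Kx , bad)

            reflects : ¬ (∃ λ y → K y × Bad φ₁ y) → ∀ x → Bad φ₁ x → Bad φ x
            reflects none x bad with Adj? u x
            ... | yes ux = contradiction bad (good none x ux)
            ... | no ¬ux = Bad-resp (λ t xt → off φ λ { refl → ¬ux (Adj-sym xt) }) bad

        repaired : Repaired
        repaired =
          let (f , spoils) = spoiler (V .proper) (Adj-sym ur)
              -- Only the spoiler of `r` has to be avoided; repeating it fills the three slots.
              (q , q-free , q≢f , _) = chooseColor φ u f f f
          in repairedBy q-free λ bad → q≢f (spoils q ((λ t ut _ → q-free t ut) , bad))

      -- Repair at every vertex, and existence of a valid coloring.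

      Fine : Coloring → Fin n → Set
      Fine φ v = ∃ (Adj v) → ¬ Bad φ v

      -- Unless `v` touches `R` or is isolated, it has a neighbor `u` touching `R`, and the repair
      -- around `u` leaves no neighbor of `u` bad.
      repair : ∀ φ → Valid φ → ∀ v →
        ∃ λ ψ → Valid ψ × Fine ψ v × (∀ x → Fine φ x → Fine ψ x)
      repair φ V v with touches? v | any? (Adj? v)
      ... | yes t | _ = φ , V , (λ _ → touches⇒¬Bad V t) , λ _ fine → fine
      ... | no _  | no isolated = φ , V , (λ nb → contradiction nb isolated) , λ _ fine → fine
      ... | no ¬t | yes (x , vx) =
        let (u , vu , r , ur , r∈R) = touchingNeighbor
            (ψ , Vψ , good , reflects) = repaired V ur r∈R
        in ψ , Vψ , (λ _ → good v (Adj-sym vu)) , λ y fine nb → fine nb ∘ reflects y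
        where
        touchingNeighbor : ∃ λ u → Adj v u × Touches u
        touchingNeighbor with dominating v
        ... | r , r∈R , inj₁ refl               = x , vx , v , Adj-sym vx , r∈R
        ... | r , r∈R , inj₂ (inj₁ vr)          = contradiction (r , vr , r∈R) ¬t
        ... | r , r∈R , inj₂ (inj₂ (m , vm , mr)) = m , vm , r , mr , r∈R

      Starred : Coloring → Set
      Starred φ = (∀ {x} → x ∈ R → φ x ≡ star) × (∀ {x} → φ x ≡ star → x ∈ R)

      -- Avoids φ x (φ x) says that no edge at x is monochromatic.
      cleanUp : ∀ φ → Starred φ → ∀ v →
        ∃ λ ψ → Starred ψ × Avoids ψ v (ψ v) × (∀ x → Avoids φ x (φ x) → Avoids ψ x (ψ x))
      cleanUp φ S@(on , only) v with v ∈? R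
      ... | yes v∈R = φ , S ,
        (λ t vt eq → packed (only (trans eq (on v∈R))) v∈R (adj⇒≢ (Adj-sym vt))
          (inj₂ (inj₁ (Adj-sym vt)))) ,
        λ _ av → av
      ... | no v∉R with chooseColor φ v star star star
      ...   | q , q-free , q≢star , _ = ψ , (on' , only') , clean , keep
        where
        ψ : Coloring
        ψ = φ [ v ≔ q ]

        on' : ∀ {x} → x ∈ R → ψ x ≡ star
        on' x∈R = trans (off φ λ { refl → v∉R x∈R }) (on x∈R)

        only' : ∀ {x} → ψ x ≡ star → x ∈ R
        only' {x} eq with x ≟ v
        ... | yes refl = contradiction (trans (sym (at φ x)) eq) q≢star
        ... | no x≢v   = only (trans (sym (off φ x≢v)) eq)

        clean : Avoids ψ v (ψ v)
        clean t vt eq = q-free t vt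
          (trans (sym (off φ (adj⇒≢ (Adj-sym vt)))) (trans eq (at φ v)))

        keep : ∀ x → Avoids φ x (φ x) → Avoids ψ x (ψ x)
        keep x av t xt eq with x ≟ v | t ≟ v
        ... | yes refl | _        = clean t xt eq
        ... | no _     | yes refl = clean x (Adj-sym xt) (sym eq)
        ... | no x≢v   | no t≢v   = av t xt (trans (sym (off φ t≢v)) (trans eq (off φ x≢v)))

      initial : ∃ Valid
      initial =
        let (φ , (on , only) , clean) = repairAll cleanUp φ₀ (φ₀-on , φ₀-only)
        in φ , record { proper = λ x y xy eq → clean x y xy (sym eq)
                      ; star-on = on ; star-only = only }
        where
        φ₀ : Coloring
        φ₀ x with x ∈? R
        ... | yes _ = star
        ... | no _  = suc zero

        φ₀-on : ∀ {x} → x ∈ R → φ₀ x ≡ star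
        φ₀-on {x} x∈R with x ∈? R
        ... | yes _   = refl
        ... | no x∉R  = contradiction x∈R x∉R

        φ₀-only : ∀ {x} → φ₀ x ≡ star → x ∈ R
        φ₀-only {x} eq with x ∈? R
        φ₀-only {x} eq | yes x∈R = x∈R
        φ₀-only {x} () | no _

      valid-fine : ∃ λ φ → Valid φ × ∀ v → Fine φ v
      valid-fine = let (φ , V) = initial in repairAll repair φ V

      pcf : PCFColorable G (4 + Δ G)
      pcf = let (φ , V , fine) = valid-fine in
        φ , V .proper , λ { v (x , x∈) → ¬Bad⇒AppearsOnce φ v (fine v (x , ∈N⇒Adj G x∈)) }

-- The bound for claw-free and for quasi-line graphs.

clawFree⇒pcf : ∀ {n} (G : Graph n) → ClawFree G → PCFColorable G (4 + Δ G)
clawFree⇒pcf G claw =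
  let (R , packed , dominating) = maximalIndependent (Near? G) (inj₁ refl) (Near-sym G)
  in pcf G claw R packed dominating

theorem1p10 : (n : ℕ) (G : Graph n) → QuasiLine G → χpcf G ≤ Δ G + 4
theorem1p10 n G ql = proj₂ (χpcf-isLeast G) (Δ G + 4)
  (subst (PCFColorable G) (+-comm 4 (Δ G)) (clawFree⇒pcf G (quasiLine⇒clawFree G ql)))
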